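{- Let $G$ be a perfectly labeled graph on $[n]$. If $G$ is crossing closed, then $NC_G$ is a supersolvable lattice.
   Context: Graphs are finite simple graphs with vertex set $[n]$; edges are written $ij$ with $i<j$. Two edges $a_1a_2$ and $b_1b_2$ cross if $a_1<b_1<a_2<b_2$ or $b_1<a_1<b_2<a_2$. $G$ is perfectly labeled if whenever $ik,jk\in E(G)$ with $i<j<k$, also $ij\in E(G)$. A bond of $G$ is a spanning subgraph (identified with its edge set) each of whose connected components is an induced subgraph of $G$; it is noncrossing if there are no two distinct components with vertex sets $B,B'$ and $a,c\in B$, $b,d\in B'$, $a<b<c<d$. $NC_G$ is the poset of noncrossing bonds ordered by inclusion of edge sets. Two crossing edges $e,f$ are crossing closed if among all induced connected subgraphs of $G$ containing $e$ and $f$ there is a unique minimal one under containment; $G$ is crossing closed if every pair of crossing edges is. A finite lattice is supersolvable if it has a maximal chain $\mathbf{m}$ such that for every chain $\mathbf{c}$, the sublattice generated by $\mathbf{m}$ and $\mathbf{c}$ is distributive. -}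

module Defs where

open import Algebra.Core using (Op₂)
open import Algebra.Definitions using (_DistributesOverˡ_)
open import Data.Bool.Base using (Bool; false; T)
open import Data.Fin.Base using (Fin; _<_)
open import Data.Fin.Subset using (Subset)
import Data.Fin.Subset as Subset
open import Data.List.Relation.Unary.Enumerates.Setoid using (IsEnumeration)
open import Data.Nat.Base using (ℕ)
open import Data.Product using (∃; ∃!; ∃-syntax; _×_; _,_; proj₁; proj₂)
open import Data.Sum.Base using (_⊎_)
open import Function.Base using (id; _on_)
open import Level using (0ℓ)
open import Relation.Binary.Bundles using (Poset)
open import Relation.Binary.Construct.Closure.ReflexiveTransitive using (Star)
open import Relation.Binary.Core using (Rel)
open import Relation.Binary.Lattice.Bundles using (Lattice)
open import Relation.Binary.Lattice.Structures using (IsLattice)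
open import Relation.Binary.PropositionalEquality.Core using (_≡_)
open import Relation.Nullary.Negation.Core using (¬_)
open import Relation.Unary using (Pred; _∈_; _⊆_; _∪_; _≐_)

-- The vertex set [n] is Fin n, so vertex labels start at 0.
record Graph (n : ℕ) : Set where
  field
    adj        : Fin n → Fin n → Bool
    adj-sym    : ∀ i j → adj i j ≡ adj j i
    adj-irrefl : ∀ i → adj i i ≡ false

Edge : ∀ {n} → Graph n → Rel (Fin n) 0ℓ
Edge G i j = T (Graph.adj G i j)

module _ {n : ℕ} where

  PerfectlyLabeled : Graph n → Set
  PerfectlyLabeled G =
    ∀ {i j k} → i < j → j < k → Edge G i k → Edge G j k → Edge G i j

  -- The edges a₁a₂ and b₁b₂; each disjunct already forces a₁ < a₂ and b₁ < b₂.
  Cross : (a₁ a₂ b₁ b₂ : Fin n) → Set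
  Cross a₁ a₂ b₁ b₂ = (a₁ < b₁ × b₁ < a₂ × a₂ < b₂) ⊎ (b₁ < a₁ × a₁ < b₂ × b₂ < a₂)

  -- Induced subgraphs are given by their vertex sets; containment of induced
  -- subgraphs is then containment of vertex sets.
  InducedEdge : Graph n → Subset n → Rel (Fin n) 0ℓ
  InducedEdge G S i j = i Subset.∈ S × j Subset.∈ S × Edge G i j

  InducedConnected : Graph n → Subset n → Set
  InducedConnected G S = ∀ {i j} → i Subset.∈ S → j Subset.∈ S → Star (InducedEdge G S) i j

  Minimal : Pred (Subset n) 0ℓ → Pred (Subset n) 0ℓ
  Minimal P S = P S × (∀ {S′} → P S′ → S′ Subset.⊆ S → S′ ≡ S)

  ConnectedContaining : Graph n → (a₁ a₂ b₁ b₂ : Fin n) → Pred (Subset n) 0ℓ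
  ConnectedContaining G a₁ a₂ b₁ b₂ S =
    InducedConnected G S × InducedEdge G S a₁ a₂ × InducedEdge G S b₁ b₂

  CrossingClosed : Graph n → Set
  CrossingClosed G =
    ∀ {a₁ a₂ b₁ b₂} → Edge G a₁ a₂ → Edge G b₁ b₂ → Cross a₁ a₂ b₁ b₂ →
    ∃! _≡_ (Minimal (ConnectedContaining G a₁ a₂ b₁ b₂))

  -- The vertex set of the connected component of v; edges are symmetric, so
  -- directed reachability is connectedness.
  component : Graph n → Fin n → Pred (Fin n) 0ℓ
  component H v w = Star (Edge H) v w

  _⊆ᴱ_ : Rel (Graph n) 0ℓ
  H ⊆ᴱ K = ∀ {i j} → Edge H i j → Edge K i j

  record IsBond (G H : Graph n) : Set where
    field
      subgraph : H ⊆ᴱ G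
      induced  : ∀ v {i j} → i ∈ component H v → j ∈ component H v → Edge G i j → Edge H i j

  Noncrossing : Graph n → Set
  Noncrossing H =
    ∀ u v → ¬ (component H u ≐ component H v) →
    ∀ {a b c d} → a ∈ component H u → c ∈ component H u →
                  b ∈ component H v → d ∈ component H v →
                  ¬ (a < b × b < c × c < d)

  record NoncrossingBond (G : Graph n) : Set where
    field
      graph       : Graph n
      isBond      : IsBond G graph
      noncrossing : Noncrossing graph

  open NoncrossingBond using (graph)

  -- Bonds are identified with their edge sets: equality is mutual inclusion.
  NC : Graph n → Poset 0ℓ 0ℓ 0ℓ
  NC G = record
    { Carrier = NoncrossingBond G
    ; _≈_     = λ H K → (graph H ⊆ᴱ graph K) × (graph K ⊆ᴱ graph H)
    ; _≤_     = λ H K → graph H ⊆ᴱ graph K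
    ; isPartialOrder = record
      { isPreorder = record
        { isEquivalence = record
          { refl  = id , id
          ; sym   = λ (p , q) → q , p
          ; trans = λ (p , q) (r , s) → (λ e → r (p e)) , (λ e → q (s e))
          }
        ; reflexive = λ (p , _) → p
        ; trans     = λ p q e → q (p e)
        }
      ; antisym = λ p q → p , q
      }
    }

Distributive : Lattice 0ℓ 0ℓ 0ℓ → Set
Distributive L = _DistributesOverˡ_ _≈_ _∧_ _∨_
  where open Lattice L

module _ (L : Lattice 0ℓ 0ℓ 0ℓ) where
  open Lattice L

  IsChain : Pred Carrier 0ℓ → Set
  IsChain c = ∀ {x y} → x ∈ c → y ∈ c → x ≤ y ⊎ y ≤ x

  -- Maximality makes such an m closed under _≈_.
  IsMaximalChain : Pred Carrier 0ℓ → Set₁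
  IsMaximalChain m = IsChain m × (∀ c → IsChain c → m ⊆ c → c ⊆ m)

  data Generated (S : Pred Carrier 0ℓ) : Pred Carrier 0ℓ where
    gen    : ∀ {x} → x ∈ S → x ∈ Generated S
    join   : ∀ {x y} → x ∈ Generated S → y ∈ Generated S → (x ∨ y) ∈ Generated S
    meet   : ∀ {x y} → x ∈ Generated S → y ∈ Generated S → (x ∧ y) ∈ Generated S
    resp-≈ : ∀ {x y} → x ≈ y → x ∈ Generated S → y ∈ Generated S

  generatedSublattice : Pred Carrier 0ℓ → Lattice 0ℓ 0ℓ 0ℓ
  generatedSublattice S = record
    { Carrier = ∃ (Generated S)
    ; _≈_     = _≈_ on proj₁
    ; _≤_     = _≤_ on proj₁
    ; _∨_     = λ (x , p) (y , q) → x ∨ y , join p q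
    ; _∧_     = λ (x , p) (y , q) → x ∧ y , meet p q
    ; isLattice = record
      { isPartialOrder = record
        { isPreorder = record
          { isEquivalence = record { refl = Eq.refl ; sym = Eq.sym ; trans = Eq.trans }
          ; reflexive     = reflexive
          ; trans         = trans
          }
        ; antisym = antisym
        }
      ; supremum = λ (x , _) (y , _) → x≤x∨y x y , y≤x∨y x y , λ _ → ∨-least
      ; infimum  = λ (x , _) (y , _) → x∧y≤x x y , x∧y≤y x y , λ _ → ∧-greatest
      }
    }

  record IsSupersolvable : Set₁ where
    field
      finite       : ∃ (IsEnumeration setoid)
      supersolving : ∃[ m ] IsMaximalChain m ×
                     (∀ c → IsChain c → Distributive (generatedSublattice (m ∪ c)))

record IsSupersolvableLattice (P : Poset 0ℓ 0ℓ 0ℓ) : Set₁ where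
  open Poset P
  field
    _∨_ _∧_   : Op₂ Carrier
    isLattice : IsLattice _≈_ _≤_ _∨_ _∧_

  lattice : Lattice 0ℓ 0ℓ 0ℓ
  lattice = record { isLattice = isLattice }

  field
    isSupersolvable : IsSupersolvable lattice

{-# OPTIONS --safe #-}
-- Since G is perfectly labeled, every connected component of a bond descends to its minimum, so
-- a bond H is controlled by the set λ(H) of vertices that are not the minimum of their component:
-- H ⊆ K and λ(H) = λ(K) force H = K.  Crossing closedness makes the intersection of two
-- noncrossing bonds noncrossing.  The bonds mₖ = G[{0,…,k}] form a maximal chain, and λ turns
-- joins and meets with mₖ into unions and intersections.  For a chain c, every element generated
-- by m and c lies between a join of elements mᵢ ∧ cⱼ and a meet of elements mᵢ ∨ cⱼ whose images
-- under λ agree, hence is equal to both; so λ embeds the generated sublattice into a lattice of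
-- sets, which is distributive.
module Submission where

open import Defs
open import Data.Bool.Base as Bool using (T)
open import Data.Bool.Properties using (T-∧; T-≡; T?)
open import Data.Empty using (⊥-elim)
open import Data.Fin.Base using (Fin; _<_; toℕ; finToFun; funToFin)
import Data.Fin.Induction as Fin
import Data.Fin.Properties as Fin
open import Data.Fin.Subset using (Subset; ∣_∣)
import Data.Fin.Subset as Subset
import Data.Fin.Subset.Properties as Subset
open import Data.List.Base using (List; []; _∷_; foldr; filter; map; allFin)
open import Data.List.Membership.Propositional.Properties using (∈-allFin)
import Data.List.Membership.Setoid as SetoidList
import Data.List.Membership.Setoid.Properties as SetoidMembership
open import Data.List.Relation.Unary.All using (All; []; _∷_)
import Data.List.Relation.Unary.All as All
import Data.List.Relation.Unary.All.Properties as All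
open import Data.List.Relation.Unary.Any using (here; there)
import Data.List.Relation.Unary.Any as Any
import Data.List.Relation.Unary.Any.Properties as Any
open import Data.List.Relation.Unary.Enumerates.Setoid using (IsEnumeration)
open import Data.Nat.Base as ℕ using (ℕ; zero; suc; _⊔_)
import Data.Nat.Induction as ℕ
import Data.Nat.Properties as ℕ
open import Data.Product using (∃; ∃₂; ∃-syntax; _×_; _,_; proj₁; proj₂)
open import Data.Product.Properties using (≡-dec; ,-injective)
open import Data.Sum.Base using (_⊎_; inj₁; inj₂; [_,_]′)
open import Data.Vec.Base using (tabulate)
open import Data.Vec.Properties using ([]=⇒lookup; lookup⇒[]=; lookup∘tabulate)
open import Function.Base using (id; _∘_; case_of_)
open import Function.Bundles using (Equivalence; mk⇔)
open import Induction.WellFounded using (Acc; acc)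
open import Level using (0ℓ)
open import Relation.Binary.Bundles using (Poset)
open import Relation.Binary.Construct.Closure.ReflexiveTransitive
  using (Star; ε; _◅_; _◅◅_; reverse)
import Relation.Binary.Construct.Closure.ReflexiveTransitive as Star
open import Relation.Binary.Core using (Rel)
open import Relation.Binary.Definitions using (Decidable; DecidableEquality; tri<; tri≈; tri>)
open import Relation.Binary.Lattice.Bundles using (Lattice)
open import Relation.Binary.Lattice.Structures
  using (IsLattice; IsBoundedMeetSemilattice; IsMeetSemilattice)
open import Relation.Binary.PropositionalEquality
  using (_≡_; _≢_; refl; sym; trans; cong; cong₂; subst)
open import Relation.Nullary.Decidable
  using (Dec; yes; no; isYes; isYes≗does; does-⇔; toWitness; fromWitness; map′; _×-dec_; _→-dec_;
         ¬?; decidable-stable)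
open import Relation.Nullary.Negation.Core using (¬_; contradiction)
open import Relation.Unary using (Pred; _∈_; _⊆_; _∪_; _∩_)

-- Joins from finite meets.

module FiniteMeets (P : Poset 0ℓ 0ℓ 0ℓ) where

  open Poset P

  module Join
    {_⋏_ : Carrier → Carrier → Carrier} {⊤ : Carrier}
    (isBMS : IsBoundedMeetSemilattice _≈_ _≤_ _⋏_ ⊤)
    (_≤?_ : Decidable _≤_)
    {xs : List Carrier} (enumerates : IsEnumeration Eq.setoid xs)
    where

    open IsBoundedMeetSemilattice isBMS
      using (maximum; x∧y≤x; x∧y≤y; ∧-greatest; isMeetSemilattice)
    open SetoidList Eq.setoid using () renaming (_∈_ to _∈ₗ_)

    ⋀ : List Carrier → Carrier
    ⋀ = foldr _⋏_ ⊤

    ⋀-lower : ∀ {x ys} → x ∈ₗ ys → ⋀ ys ≤ x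
    ⋀-lower (here x≈y)   = Poset.trans P (x∧y≤x _ _) (reflexive (Eq.sym x≈y))
    ⋀-lower (there x∈ys) = Poset.trans P (x∧y≤y _ _) (⋀-lower x∈ys)

    ⋀-greatest : ∀ {x ys} → All (x ≤_) ys → x ≤ ⋀ ys
    ⋀-greatest []         = maximum _
    ⋀-greatest (x≤y ∷ ps) = ∧-greatest x≤y (⋀-greatest ps)

    upperBound? : ∀ x y z → Dec (x ≤ z × y ≤ z)
    upperBound? x y z = (x ≤? z) ×-dec (y ≤? z)

    _⋎_ : Carrier → Carrier → Carrier
    x ⋎ y = ⋀ (filter (upperBound? x y) xs)

    isLattice : IsLattice _≈_ _≤_ _⋎_ _⋏_
    isLattice = record
      { isPartialOrder = isPartialOrder
      ; supremum = λ x y →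
            ⋀-greatest (All.map proj₁ (All.all-filter (upperBound? x y) xs))
          , ⋀-greatest (All.map proj₂ (All.all-filter (upperBound? x y) xs))
          , λ z x≤z y≤z → ⋀-lower (SetoidMembership.∈-filter⁺ Eq.setoid (upperBound? x y)
              (λ z≈w (x≤z , y≤z) → ≤-respʳ-≈ z≈w x≤z , ≤-respʳ-≈ z≈w y≤z)
              (enumerates z) (x≤z , y≤z))
      ; infimum = IsMeetSemilattice.infimum isMeetSemilattice
      }

-- Distributivity from a labelling by sets.

module ModularChain (L : Lattice 0ℓ 0ℓ 0ℓ) where

  open Lattice L renaming (_∧_ to _⋏_; _∨_ to _⋎_)

  module Labelled
    {I : Set} (label : Carrier → Pred I 0ℓ)
    (label-mono   : ∀ {x y} → x ≤ y → label x ⊆ label y)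
    (label-strict : ∀ {x y} → x ≤ y → label y ⊆ label x → y ≤ x)
    (m : Pred Carrier 0ℓ) (m-chain : IsChain L m)
    (label-∨ : ∀ {a} x → a ∈ m → label (x ⋎ a) ⊆ label x ∪ label a)
    (label-∧ : ∀ {a} x → a ∈ m → label x ∩ label a ⊆ label (x ⋏ a))
    {⊤ ⊥ : Carrier} (⊤∈m : ⊤ ∈ m) (⊥∈m : ⊥ ∈ m)
    (maximum : ∀ x → x ≤ ⊤) (minimum : ∀ x → ⊥ ≤ x)
    (c : Pred Carrier 0ℓ) (c-chain : IsChain L c)
    where

    -- Adjoining `⊤` and `⊥` to `c` gives generators from `m` and from `c` the same shape: an `a` in
    -- `m` is squeezed between `⊤ ⋏ a` and `⊥ ⋎ a`, and a `d` in `c` between `d ⋏ ⊤` and `d ⋎ ⊥`.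
    data Bounded : Pred Carrier 0ℓ where
      top    : ⊤ ∈ Bounded
      bottom : ⊥ ∈ Bounded
      inner  : c ⊆ Bounded

    bounded-chain : IsChain L Bounded
    bounded-chain _         top       = inj₁ (maximum _)
    bounded-chain top       _         = inj₂ (maximum _)
    bounded-chain bottom    _         = inj₁ (minimum _)
    bounded-chain _         bottom    = inj₂ (minimum _)
    bounded-chain (inner p) (inner q) = c-chain p q

    chain-lower : ∀ {C x y} → IsChain L C → x ∈ C → y ∈ C →
      ∃[ z ] z ∈ C × z ≤ x × z ≤ y × label x ∩ label y ⊆ label z
    chain-lower chain p q with chain p q
    ... | inj₁ x≤y = _ , p , Lattice.refl L , x≤y , proj₁
    ... | inj₂ y≤x = _ , q , y≤x , Lattice.refl L , proj₂

    chain-upper : ∀ {C x y} → IsChain L C → x ∈ C → y ∈ C →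
      ∃[ z ] z ∈ C × x ≤ z × y ≤ z × label z ⊆ label x ∪ label y
    chain-upper chain p q with chain p q
    ... | inj₁ x≤y = _ , q , x≤y , Lattice.refl L , inj₂
    ... | inj₂ y≤x = _ , p , Lattice.refl L , y≤x , inj₁

    ∧-mono : ∀ {x y u v} → x ≤ u → y ≤ v → x ⋏ y ≤ u ⋏ v
    ∧-mono p q = ∧-greatest (Lattice.trans L (x∧y≤x _ _) p) (Lattice.trans L (x∧y≤y _ _) q)

    ∨-mono : ∀ {x y u v} → x ≤ u → y ≤ v → x ⋎ y ≤ u ⋎ v
    ∨-mono p q = ∨-least (Lattice.trans L p (x≤x∨y _ _)) (Lattice.trans L q (y≤x∨y _ _))

    -- The second index is the label that the expression would have if label were a homomorphism.
    data JoinForm : Carrier → Pred I 0ℓ → Set₁ where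
      atom : ∀ {a d} → a ∈ m → d ∈ Bounded → JoinForm (d ⋏ a) (label d ∩ label a)
      _∨_  : ∀ {x y s t} → JoinForm x s → JoinForm y t → JoinForm (x ⋎ y) (s ∪ t)

    data MeetForm : Carrier → Pred I 0ℓ → Set₁ where
      atom : ∀ {a d} → a ∈ m → d ∈ Bounded → MeetForm (d ⋎ a) (label d ∪ label a)
      _∧_  : ∀ {x y s t} → MeetForm x s → MeetForm y t → MeetForm (x ⋏ y) (s ∩ t)

    joinForm-label : ∀ {x s} → JoinForm x s → s ⊆ label x
    joinForm-label (atom a∈m _) p        = label-∧ _ a∈m p
    joinForm-label (j ∨ k)      (inj₁ p) = label-mono (x≤x∨y _ _) (joinForm-label j p)
    joinForm-label (j ∨ k)      (inj₂ p) = label-mono (y≤x∨y _ _) (joinForm-label k p)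

    meetForm-label : ∀ {x s} → MeetForm x s → label x ⊆ s
    meetForm-label (atom a∈m _) p = label-∨ _ a∈m p
    meetForm-label (j ∧ k)      p =
      meetForm-label j (label-mono (x∧y≤x _ _) p) , meetForm-label k (label-mono (x∧y≤y _ _) p)

    joinForm-∧ : ∀ {x y s t} → JoinForm x s → JoinForm y t →
      ∃₂ λ z u → JoinForm z u × z ≤ x × z ≤ y × s ∩ t ⊆ u
    joinForm-∧ (atom a∈m d∈c) (atom a′∈m d′∈c) =
      let _ , a∈ , a≤ , a≤′ , la = chain-lower m-chain a∈m a′∈m
          _ , d∈ , d≤ , d≤′ , ld = chain-lower bounded-chain d∈c d′∈c
      in _ , _ , atom a∈ d∈ , ∧-mono d≤ a≤ , ∧-mono d≤′ a≤′ ,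
         λ ((d , a) , (d′ , a′)) → ld (d , d′) , la (a , a′)
    joinForm-∧ (j ∨ k) l =
      let _ , _ , e , e≤ , e≤′ , le = joinForm-∧ j l
          _ , _ , f , f≤ , f≤′ , lf = joinForm-∧ k l
      in _ , _ , (e ∨ f) , ∨-mono e≤ f≤ , ∨-least e≤′ f≤′ ,
         λ { (inj₁ p , q) → inj₁ (le (p , q)) ; (inj₂ p , q) → inj₂ (lf (p , q)) }
    joinForm-∧ j@(atom _ _) (k ∨ l) =
      let _ , _ , e , e≤ , e≤′ , le = joinForm-∧ j k
          _ , _ , f , f≤ , f≤′ , lf = joinForm-∧ j l
      in _ , _ , (e ∨ f) , ∨-least e≤ f≤ , ∨-mono e≤′ f≤′ ,
         λ { (p , inj₁ q) → inj₁ (le (p , q)) ; (p , inj₂ q) → inj₂ (lf (p , q)) }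

    -- The order dual of `joinForm-∧`.
    meetForm-∨ : ∀ {x y s t} → MeetForm x s → MeetForm y t →
      ∃₂ λ z u → MeetForm z u × x ≤ z × y ≤ z × u ⊆ s ∪ t
    meetForm-∨ (atom a∈m d∈c) (atom a′∈m d′∈c) =
      let _ , a∈ , a≤ , a≤′ , la = chain-upper m-chain a∈m a′∈m
          _ , d∈ , d≤ , d≤′ , ld = chain-upper bounded-chain d∈c d′∈c
      in _ , _ , atom a∈ d∈ , ∨-mono d≤ a≤ , ∨-mono d≤′ a≤′ ,
         [ (λ p → [ inj₁ ∘ inj₁ , inj₂ ∘ inj₁ ]′ (ld p))
         , (λ p → [ inj₁ ∘ inj₂ , inj₂ ∘ inj₂ ]′ (la p)) ]′
    meetForm-∨ (j ∧ k) l =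
      let _ , _ , e , e≤ , e≤′ , le = meetForm-∨ j l
          _ , _ , f , f≤ , f≤′ , lf = meetForm-∨ k l
      in _ , _ , (e ∧ f) , ∧-mono e≤ f≤ , ∧-greatest e≤′ f≤′ ,
         λ (p , q) → case (le p , lf q) of λ
           { (inj₁ p , inj₁ q) → inj₁ (p , q) ; (inj₂ p , _) → inj₂ p ; (_ , inj₂ q) → inj₂ q }
    meetForm-∨ j@(atom _ _) (k ∧ l) =
      let _ , _ , e , e≤ , e≤′ , le = meetForm-∨ j k
          _ , _ , f , f≤ , f≤′ , lf = meetForm-∨ j l
      in _ , _ , (e ∧ f) , ∧-greatest e≤ f≤ , ∧-mono e≤′ f≤′ ,
         λ (p , q) → case (le p , lf q) of λ
           { (inj₂ p , inj₂ q) → inj₂ (p , q) ; (inj₁ p , _) → inj₁ p ; (_ , inj₁ q) → inj₁ q }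

    -- The inclusion `agree` closes the cycle `upperLabel` ⊆ `lowerLabel` ⊆ `label lower` ⊆
    -- `label x` ⊆ `label upper` ⊆ `upperLabel`, so all these sets coincide.
    record Sandwiched (x : Carrier) : Set₁ where
      constructor sandwich
      field
        {lower upper}           : Carrier
        {lowerLabel upperLabel} : Pred I 0ℓ
        joinForm : JoinForm lower lowerLabel
        meetForm : MeetForm upper upperLabel
        lower≤   : lower ≤ x
        ≤upper   : x ≤ upper
        agree    : upperLabel ⊆ lowerLabel

    -- By induction on the generation of `x`. For a join, the lower bounds are joined formally and
    -- `meetForm-∨` supplies the upper bound; for a meet the roles are exchanged.
    generated-sandwiched : ∀ {x} → x ∈ Generated L (m ∪ c) → Sandwiched x
    generated-sandwiched (gen (inj₁ x∈m)) =
      sandwich (atom x∈m top) (atom x∈m bottom) (x∧y≤y _ _) (y≤x∨y _ _)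
        λ { (inj₁ p) → label-mono (maximum _) p , label-mono (minimum _) p
          ; (inj₂ p) → label-mono (maximum _) p , p }
    generated-sandwiched (gen (inj₂ x∈c)) =
      sandwich (atom ⊤∈m (inner x∈c)) (atom ⊥∈m (inner x∈c)) (x∧y≤x _ _) (x≤x∨y _ _)
        λ { (inj₁ p) → p , label-mono (maximum _) p
          ; (inj₂ p) → label-mono (minimum _) p , label-mono (maximum _) p }
    generated-sandwiched (join g h) with generated-sandwiched g | generated-sandwiched h
    ... | sandwich j k j≤ ≤k k⊆j | sandwich j′ k′ j≤′ ≤k′ k⊆j′ =
      let _ , _ , l , k≤l , k′≤l , l⊆ = meetForm-∨ k k′
      in sandwich (j ∨ j′) l (∨-mono j≤ j≤′)
           (∨-least (Lattice.trans L ≤k k≤l) (Lattice.trans L ≤k′ k′≤l))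
           (λ p → [ inj₁ ∘ k⊆j , inj₂ ∘ k⊆j′ ]′ (l⊆ p))
    generated-sandwiched (meet g h) with generated-sandwiched g | generated-sandwiched h
    ... | sandwich j k j≤ ≤k k⊆j | sandwich j′ k′ j≤′ ≤k′ k⊆j′ =
      let _ , _ , l , l≤j , l≤j′ , ⊆l = joinForm-∧ j j′
      in sandwich l (k ∧ k′)
           (∧-greatest (Lattice.trans L l≤j j≤) (Lattice.trans L l≤j′ j≤′))
           (∧-mono ≤k ≤k′)
           (λ (p , q) → ⊆l (k⊆j p , k⊆j′ q))
    generated-sandwiched (resp-≈ x≈y g) with generated-sandwiched g
    ... | sandwich j k j≤ ≤k k⊆j =
      sandwich j k (≤-respʳ-≈ x≈y j≤) (≤-respˡ-≈ x≈y ≤k) k⊆j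

    -- The meet form above `x ⋎ y` has its label inside the union of the two upper labels, and by
    -- `agree` these are already labels of elements below `x` and below `y`.
    sandwiched-∨ : ∀ {x y} → Sandwiched x → Sandwiched y → label (x ⋎ y) ⊆ label x ∪ label y
    sandwiched-∨ (sandwich j k j≤ ≤k k⊆j) (sandwich j′ k′ j≤′ ≤k′ k⊆j′) p =
      let _ , _ , l , k≤l , k′≤l , l⊆ = meetForm-∨ k k′
          x∨y≤l = ∨-least (Lattice.trans L ≤k k≤l) (Lattice.trans L ≤k′ k′≤l)
      in [ inj₁ ∘ label-mono j≤ ∘ joinForm-label j ∘ k⊆j
         , inj₂ ∘ label-mono j≤′ ∘ joinForm-label j′ ∘ k⊆j′
         ]′ (l⊆ (meetForm-label l (label-mono x∨y≤l p)))

    sandwiched-∧ : ∀ {x y} → Sandwiched x → Sandwiched y → label x ∩ label y ⊆ label (x ⋏ y)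
    sandwiched-∧ (sandwich j k j≤ ≤k k⊆j) (sandwich j′ k′ j≤′ ≤k′ k⊆j′) (p , q) =
      let _ , _ , l , l≤j , l≤j′ , ⊆l = joinForm-∧ j j′
          l≤x∧y = ∧-greatest (Lattice.trans L l≤j j≤) (Lattice.trans L l≤j′ j≤′)
      in label-mono l≤x∧y (joinForm-label l
           (⊆l (k⊆j (meetForm-label k (label-mono ≤k p)) ,
                k⊆j′ (meetForm-label k′ (label-mono ≤k′ q)))))

    -- One inequality holds in every lattice. On generated elements `label` respects joins and
    -- meets, so both sides have the same label, and `label-strict` reverses the inequality.
    distributive : Distributive (generatedSublattice L (m ∪ c))
    distributive (x , g) (y , h) (z , i) = antisym (label-strict ≥ labels) ≥
      where
      x′ = generated-sandwiched g
      y′ = generated-sandwiched h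
      z′ = generated-sandwiched i
      ≥ : (x ⋏ y) ⋎ (x ⋏ z) ≤ x ⋏ (y ⋎ z)
      ≥ = ∨-least (∧-mono (Lattice.refl L) (x≤x∨y _ _)) (∧-mono (Lattice.refl L) (y≤x∨y _ _))
      labels : label (x ⋏ (y ⋎ z)) ⊆ label ((x ⋏ y) ⋎ (x ⋏ z))
      labels p =
        let p₁ = label-mono (x∧y≤x _ _) p
        in [ (λ q → label-mono (x≤x∨y _ _) (sandwiched-∧ x′ y′ (p₁ , q)))
           , (λ q → label-mono (y≤x∨y _ _) (sandwiched-∧ x′ z′ (p₁ , q)))
           ]′ (sandwiched-∨ y′ z′ (label-mono (x∧y≤y _ _) p))

-- Descent to the minimum of a component.

module _ {n : ℕ} where

  Connected : Graph n → Rel (Fin n) 0ℓ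
  Connected H = Star (Edge H)

  edge-sym : ∀ (H : Graph n) {i j} → Edge H i j → Edge H j i
  edge-sym H {i} {j} = subst T (Graph.adj-sym H i j)

  edge-irrefl : ∀ (H : Graph n) {i} → ¬ Edge H i i
  edge-irrefl H {i} = subst T (Graph.adj-irrefl H i)

  connected-sym : ∀ (H : Graph n) {i j} → Connected H i j → Connected H j i
  connected-sym H = reverse (λ {i} {j} → edge-sym H {i} {j})

  edge? : (H : Graph n) → Decidable (Edge H)
  edge? H i j = T? (Graph.adj H i j)

  Down : Graph n → Rel (Fin n) 0ℓ
  Down H j i = i < j × Edge H j i

  -- This is the label λ(H). For a perfectly labeled graph, a single lower neighbour detects that a
  -- vertex is not the minimum of its component, which makes the label visibly monotone in the edge
  -- set.
  NonMinimal : Graph n → Pred (Fin n) 0ℓ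
  NonMinimal H j = ∃ (Down H j)

  nonMinimal? : (H : Graph n) (j : Fin n) → Dec (NonMinimal H j)
  nonMinimal? H j = Fin.any? λ i → (i Fin.<? j) ×-dec edge? H j i

  down⇒connected : ∀ (H : Graph n) {i j} → Star (Down H) i j → Connected H i j
  down⇒connected H = Star.map proj₂

  down⇒≤ : ∀ (H : Graph n) {i j} → Star (Down H) j i → toℕ i ℕ.≤ toℕ j
  down⇒≤ H ε             = ℕ.≤-refl
  down⇒≤ H ((lt , _) ◅ p) = ℕ.≤-trans (down⇒≤ H p) (ℕ.<⇒≤ lt)

  module Roots (H : Graph n) (perfect : PerfectlyLabeled H) where

    -- Two lower neighbours of `k` are equal or, by perfect labeling, adjacent, so the larger
    -- descends to the smaller. Repeating this along the path gives confluence of `Down`.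
    strip : ∀ {k i w} → Down H k i → Star (Down H) k w →
      ∃[ w′ ] Star (Down H) i w′ × Star (Down H) w w′
    strip d ε = _ , ε , d ◅ ε
    strip {k} {i} (i<k , ki) (_◅_ {j = j} (j<k , kj) p) with Fin.<-cmp i j
    ... | tri< i<j _ _ =
      strip (i<j , edge-sym H (perfect i<j j<k (edge-sym H ki) (edge-sym H kj))) p
    ... | tri≈ _ refl _ = _ , p , ε
    ... | tri> _ _ j<i =
      _ , (j<i , edge-sym H (perfect j<i i<k (edge-sym H kj) (edge-sym H ki))) ◅ p , ε

    -- The Church-Rosser property of `Down`: an upward edge in the path is absorbed by `strip`, a
    -- downward edge is prepended.
    joinable : ∀ {u v} → Connected H u v → ∃[ w ] Star (Down H) u w × Star (Down H) v w
    joinable ε = _ , ε , ε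
    joinable {u} (_◅_ {j = v} e p) with joinable p | Fin.<-cmp u v
    ... | _ , v↓ , w↓ | tri> _ _ v<u  = _ , (v<u , e) ◅ v↓ , w↓
    ... | _ , v↓ , w↓ | tri≈ _ refl _ = _ , v↓ , w↓
    ... | _ , v↓ , w↓ | tri< u<v _ _  =
      let _ , u↓ , ↓ = strip (u<v , edge-sym H e) v↓ in _ , u↓ , w↓ ◅◅ ↓

    minimal-unique : ∀ {u v} → Connected H u v → ¬ NonMinimal H u → ¬ NonMinimal H v → u ≡ v
    minimal-unique p u-min v-min with joinable p
    ... | _ , ε     , ε     = refl
    ... | _ , d ◅ _ , _     = contradiction (_ , d) u-min
    ... | _ , ε     , d ◅ _ = contradiction (_ , d) v-min

    descend : ∀ v → Acc _<_ v → ∃[ r ] Star (Down H) v r × ¬ NonMinimal H r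
    descend v (acc rs) with nonMinimal? H v
    ... | no v-min = v , ε , v-min
    ... | yes (i , d@(i<v , _)) =
      let r , p , r-min = descend i (rs i<v) in r , d ◅ p , r-min

    descent : ∀ v → ∃[ r ] Star (Down H) v r × ¬ NonMinimal H r
    descent v = descend v (Fin.<-wellFounded v)

    root : Fin n → Fin n
    root v = proj₁ (descent v)

    root-minimal : ∀ v → ¬ NonMinimal H (root v)
    root-minimal v = proj₂ (proj₂ (descent v))

    root-connected : ∀ v → Connected H v (root v)
    root-connected v = down⇒connected H (proj₁ (proj₂ (descent v)))

    root-≤ : ∀ v → toℕ (root v) ℕ.≤ toℕ v
    root-≤ v = down⇒≤ H (proj₁ (proj₂ (descent v)))

    root-cong : ∀ {u v} → Connected H u v → root u ≡ root v
    root-cong {u} {v} p = minimal-unique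
      (connected-sym H (root-connected u) ◅◅ p ◅◅ root-connected v) (root-minimal u) (root-minimal v)

    root-reflects : ∀ {u v} → root u ≡ root v → Connected H u v
    root-reflects {u} {v} eq =
      root-connected u ◅◅ subst (λ r → Connected H r v) (sym eq) (connected-sym H (root-connected v))

    connected? : Decidable (Connected H)
    connected? u v = map′ root-reflects root-cong (root u Fin.≟ root v)

    minimal⇒root : ∀ {v} → ¬ NonMinimal H v → root v ≡ v
    minimal⇒root {v} v-min =
      sym (minimal-unique (root-connected v) v-min (root-minimal v))

  -- Noncrossing graphs through their edges.

  -- An edgewise form of `Noncrossing`, easier to verify for new graphs. It implies `Noncrossing`
  -- for every graph and holds for every noncrossing bond.
  CrossingsConnected : Graph n → Set
  CrossingsConnected H = ∀ {a b c d} → a < b → b < c → c < d →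
    Edge H a c → Edge H b d → Connected H a b

  connected-enter : ∀ {R : Rel (Fin n) 0ℓ} {P : Pred (Fin n) 0ℓ} → (∀ w → Dec (P w)) →
    ∀ {a c} → Star R a c → ¬ P a → P c → ∃₂ λ x y → Star R a x × R x y × ¬ P x × P y
  connected-enter P? ε       ¬Pa Pc = contradiction Pc ¬Pa
  connected-enter P? (_◅_ {j = b} r p) ¬Pa Pc with P? b
  ... | yes Pb = _ , _ , ε , r , ¬Pa , Pb
  ... | no ¬Pb =
    let x , y , q , rest = connected-enter P? p ¬Pb Pc in x , y , r ◅ q , rest

  between? : (p q w : Fin n) → Dec (p < w × w < q)
  between? p q w = (p Fin.<? w) ×-dec (w Fin.<? q)

  -- Since `z` lies outside the closed interval from `p` to `q`, the order is `z < p < w < q` or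
  -- `p < w < q < z`; in both cases `zw` crosses `pq`.
  straddle : ∀ (H : Graph n) → CrossingsConnected H → ∀ {p q z w} → Edge H p q → Edge H z w →
    p < w × w < q → ¬ (p < z × z < q) → z ≢ p → z ≢ q → Connected H p w
  straddle H cc {p} {q} {z} pq zw (p<w , w<q) ¬z z≢p z≢q with Fin.<-cmp z p | Fin.<-cmp z q
  ... | tri< z<p _ _ | _            = connected-sym H (cc z<p p<w w<q zw pq) ◅◅ zw ◅ ε
  ... | tri≈ _ z≡p _ | _            = contradiction z≡p z≢p
  ... | tri> _ _ p<z | tri< z<q _ _ = contradiction (p<z , z<q) ¬z
  ... | tri> _ _ p<z | tri≈ _ z≡q _ = contradiction z≡q z≢q
  ... | tri> _ _ p<z | tri> _ _ q<z = cc p<w w<q q<z pq (edge-sym H zw)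

  -- A path of one component that enters the interval spanned by two vertices of the other uses an
  -- edge that separates these vertices, so the path between them uses an edge crossing it.
  crossingsConnected⇒noncrossing : ∀ H → CrossingsConnected H → Noncrossing H
  crossingsConnected⇒noncrossing H cc u v u≉v {a} {b} {c} {d} ua uc vb vd (a<b , b<c , c<d) =
    conclude (connected-enter (between? b d) (connected-sym H ua ◅◅ uc)
      (λ (b<a , _) → Fin.<-asym a<b b<a) (b<c , c<d))
    where
    apart : ∀ {x y} → Connected H u x → Connected H v y → ¬ Connected H x y
    apart ux vy xy = u≉v
      ( (λ p → vy ◅◅ connected-sym H xy ◅◅ connected-sym H ux ◅◅ p)
      , (λ p → ux ◅◅ xy ◅◅ connected-sym H vy ◅◅ p))

    avoid : ∀ {p q s t} → Connected H u p → Edge H p q → Connected H v s → Connected H v t →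
      ¬ (p < s × s < q) → ¬ (p < t × t < q)
    avoid {p} {q} up pq vs vt ¬s t-in
      with connected-enter (between? p q) (connected-sym H vs ◅◅ vt) ¬s t-in
    ... | z , w , sz , zw , ¬z , w-in = apart up (vs ◅◅ sz ◅◅ zw ◅ ε)
      (straddle H cc pq zw w-in ¬z
        (λ { refl → apart up (vs ◅◅ sz) ε })
        (λ { refl → apart up (vs ◅◅ sz) (pq ◅ ε) }))

    conclude : ¬ (∃₂ λ x y → Connected H a x × Edge H x y × ¬ (b < x × x < d) × (b < y × y < d))
    conclude (x , y , ax , xy , ¬x , b<y , y<d) with Fin.<-cmp x b | Fin.<-cmp x d
    ... | tri< x<b _ _ | _ =
      avoid (ua ◅◅ ax) xy vd vb (λ (_ , d<y) → Fin.<-asym d<y y<d) (x<b , b<y)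
    ... | tri≈ _ refl _ | _ = apart (ua ◅◅ ax) vb ε
    ... | tri> _ _ b<x | tri< x<d _ _ = ¬x (b<x , x<d)
    ... | tri> _ _ b<x | tri≈ _ refl _ = apart (ua ◅◅ ax) vd ε
    ... | tri> _ _ b<x | tri> _ _ d<x =
      avoid (ua ◅◅ ax ◅◅ xy ◅ ε) (edge-sym H xy) vb vd (λ (y<b , _) → Fin.<-asym y<b b<y) (y<d , d<x)

  bond-perfectlyLabeled : ∀ (G H : Graph n) → PerfectlyLabeled G → IsBond G H → PerfectlyLabeled H
  bond-perfectlyLabeled G H perfect bond i<j j<k ik jk =
    induced _ ε (ik ◅ edge-sym H jk ◅ ε) (perfect i<j j<k (subgraph ik) (subgraph jk))
    where open IsBond bond

  -- Shrinking `B` as long as possible reaches a minimal set, which uniqueness identifies with `S`.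
  -- As `P` need not be decidable, the descent on cardinality runs by contradiction, one vertex `x`
  -- at a time, where membership is decidable.
  minimal-least : ∀ {P : Pred (Subset n) 0ℓ} {S B} → (∀ {S′} → Minimal P S′ → S ≡ S′) → P B →
    S Subset.⊆ B
  minimal-least {P} {S} {B} unique PB {x} x∈S =
    decidable-stable (x Subset.∈? B) λ x∉B → none x∉B B (ℕ.<-wellFounded ∣ B ∣) PB id
    where
    none : x Subset.∉ B → ∀ C → Acc ℕ._<_ ∣ C ∣ → P C → ¬ (C Subset.⊆ B)
    none x∉B C (acc rs) PC C⊆B = x∉B (C⊆B (subst (x Subset.∈_) (unique (PC , minimal)) x∈S))
      where
      minimal : ∀ {D} → P D → D Subset.⊆ C → D ≡ C
      minimal {D} PD D⊆C
        with Fin.any? (λ y → (y Subset.∈? C) ×-dec ¬? (y Subset.∈? D))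
      ... | yes y = contradiction (λ {_} p → C⊆B (D⊆C p))
                      (none x∉B D (rs (Subset.p⊂q⇒∣p∣<∣q∣ (D⊆C , y))) PD)
      ... | no ∄y = Subset.⊆-antisym D⊆C λ {y} y∈C →
        decidable-stable (y Subset.∈? D) λ y∉D → ∄y (y , y∈C , y∉D)

  -- Bonds as kernels of vertex maps.

  module _ {A : Set} (_≟_ : DecidableEquality A) (G : Graph n) (f : Fin n → A) where

    -- Any `f` yields a bond, since `f` is constant on components. Conversely a noncrossing bond is
    -- the kernel of its root map.
    kernel : Graph n
    kernel = record
      { adj        = λ i j → Graph.adj G i j Bool.∧ isYes (f i ≟ f j)
      ; adj-sym    = λ i j → cong₂ Bool._∧_ (Graph.adj-sym G i j)
          (trans (isYes≗does (f i ≟ f j))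
            (trans (does-⇔ (mk⇔ sym sym) (f i ≟ f j) (f j ≟ f i)) (sym (isYes≗does (f j ≟ f i)))))
      ; adj-irrefl = λ i → cong (Bool._∧ _) (Graph.adj-irrefl G i)
      }

    kernel⁺ : ∀ {i j} → Edge G i j → f i ≡ f j → Edge kernel i j
    kernel⁺ e eq = Equivalence.from T-∧ (e , fromWitness eq)

    kernel⁻ : ∀ {i j} → Edge kernel i j → Edge G i j × f i ≡ f j
    kernel⁻ e = let g , eq = Equivalence.to T-∧ e in g , toWitness eq

    kernel-connected : ∀ {i j} → Connected kernel i j → f i ≡ f j
    kernel-connected ε       = refl
    kernel-connected (e ◅ p) = trans (proj₂ (kernel⁻ e)) (kernel-connected p)

    kernel-isBond : IsBond G kernel
    kernel-isBond = record
      { subgraph = proj₁ ∘ kernel⁻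
      ; induced  = λ v vi vj e → kernel⁺ e (trans (sym (kernel-connected vi)) (kernel-connected vj))
      }

    kernelBond : CrossingsConnected kernel → NoncrossingBond G
    kernelBond cc = record
      { graph = kernel ; isBond = kernel-isBond
      ; noncrossing = crossingsConnected⇒noncrossing kernel cc }

-- Used to decode an equality of levels in `merged`: the roots agree, or both are at most `k`.
⊔-cancel : ∀ a b k → a ⊔ k ≡ b ⊔ k → a ≡ b ⊎ (a ℕ.≤ k × b ℕ.≤ k)
⊔-cancel a b k eq with ℕ.≤-total a k | ℕ.≤-total b k
... | inj₁ a≤k | inj₁ b≤k = inj₂ (a≤k , b≤k)
... | inj₁ a≤k | inj₂ k≤b = inj₂ (a≤k ,
  ℕ.≤-reflexive (trans (sym (ℕ.m≥n⇒m⊔n≡m k≤b)) (trans (sym eq) (ℕ.m≤n⇒m⊔n≡n a≤k))))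
... | inj₂ k≤a | inj₁ b≤k = inj₂ (
  ℕ.≤-reflexive (trans (sym (ℕ.m≥n⇒m⊔n≡m k≤a)) (trans eq (ℕ.m≤n⇒m⊔n≡n b≤k))) , b≤k)
... | inj₂ k≤a | inj₂ k≤b =
  inj₁ (trans (sym (ℕ.m≥n⇒m⊔n≡m k≤a)) (trans eq (ℕ.m≥n⇒m⊔n≡m k≤b)))

≤-⊔-cong : ∀ {a b k} → a ℕ.≤ k → b ℕ.≤ k → a ⊔ k ≡ b ⊔ k
≤-⊔-cong a≤k b≤k = trans (ℕ.m≤n⇒m⊔n≡n a≤k) (sym (ℕ.m≤n⇒m⊔n≡n b≤k))

-- The lattice of noncrossing bonds.

module NoncrossingBonds
  {n : ℕ} (G : Graph n) (perfect : PerfectlyLabeled G) (closed : CrossingClosed G) where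

  open NoncrossingBond using (graph; isBond; noncrossing)
  open Poset (NC G) using (_≈_; _≤_; isPartialOrder; module Eq) renaming (Carrier to NCG)

  module GRoots = Roots G perfect

  module XRoots (x : NCG) =
    Roots (graph x) (bond-perfectlyLabeled G (graph x) perfect (isBond x))

  open XRoots using (root; root-cong; root-reflects; root-≤; root-minimal; connected?)

  edge-subgraph : ∀ (x : NCG) {i j} → Edge (graph x) i j → Edge G i j
  edge-subgraph x = IsBond.subgraph (isBond x)

  edge-root : ∀ (x : NCG) {i j} → Edge (graph x) i j → root x i ≡ root x j
  edge-root x e = root-cong x (e ◅ ε)

  connected-edge : ∀ (x : NCG) {i j} → Connected (graph x) i j → Edge G i j → Edge (graph x) i j
  connected-edge x = IsBond.induced (isBond x) _ ε

  root-edge : ∀ (x : NCG) {i j} → root x i ≡ root x j → Edge G i j → Edge (graph x) i j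
  root-edge x eq = connected-edge x (root-reflects x eq)

  not-crossing : ∀ (x : NCG) {u v a b c d} → root x u ≢ root x v →
    Connected (graph x) u a → Connected (graph x) u c →
    Connected (graph x) v b → Connected (graph x) v d → ¬ (a < b × b < c × c < d)
  not-crossing x {u} {v} u≢v =
    noncrossing x u v (λ (u⊆v , _) → u≢v (sym (root-cong x (u⊆v ε))))

  crossingsConnected : ∀ (x : NCG) → CrossingsConnected (graph x)
  crossingsConnected x {a} {b} a<b b<c c<d ac bd = decidable-stable (connected? x a b) λ ¬ab →
    not-crossing x (¬ab ∘ root-reflects x) ε (ac ◅ ε) ε (bd ◅ ε) (a<b , b<c , c<d)

  component-subset : NCG → Fin n → Subset n
  component-subset x a = tabulate λ v → isYes (connected? x a v)

  ∈-component⁺ : ∀ x {a v} → Connected (graph x) a v → v Subset.∈ component-subset x a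
  ∈-component⁺ x {a} {v} p = lookup⇒[]= v _
    (trans (lookup∘tabulate _ v) (Equivalence.to T-≡ (fromWitness p)))

  ∈-component⁻ : ∀ x {a v} → v Subset.∈ component-subset x a → Connected (graph x) a v
  ∈-component⁻ x {a} {v} p = toWitness (Equivalence.from T-≡
    (trans (sym (lookup∘tabulate _ v)) ([]=⇒lookup p)))

  component-inducedConnected : ∀ x a → InducedConnected G (component-subset x a)
  component-inducedConnected x a {i} i∈ j∈ =
    walk (∈-component⁻ x i∈) (connected-sym (graph x) (∈-component⁻ x i∈) ◅◅ ∈-component⁻ x j∈)
    where
    walk : ∀ {i j} → Connected (graph x) a i → Connected (graph x) i j →
      Star (InducedEdge G (component-subset x a)) i j
    walk ai ε       = ε
    walk ai (e ◅ p) = (∈-component⁺ x ai , ∈-component⁺ x aj , edge-subgraph x e) ◅ walk aj p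
      where aj = ai ◅◅ e ◅ ε

  -- Noncrossing forces both edges into the component of `a`, so that component is one of the
  -- connected sets among which crossing closedness picks the minimal one.
  crossing-connectedContaining : ∀ x {a b c d} → a < b → b < c → c < d →
    Edge (graph x) a c → Edge (graph x) b d →
    ConnectedContaining G a c b d (component-subset x a)
  crossing-connectedContaining x a<b b<c c<d ac bd =
      component-inducedConnected x _
    , (∈-component⁺ x ε , ∈-component⁺ x (ac ◅ ε) , edge-subgraph x ac)
    , (∈-component⁺ x ab , ∈-component⁺ x (ab ◅◅ bd ◅ ε) , edge-subgraph x bd)
    where ab = crossingsConnected x a<b b<c c<d ac bd

  -- The existence half of crossing closedness: some connected induced subgraph contains both edges.
  G-crossingsConnected : CrossingsConnected G
  G-crossingsConnected a<b b<c c<d ac bd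
    with closed ac bd (inj₁ (a<b , b<c , c<d))
  ... | _ , ((conn , (a∈S , _) , (b∈S , _)) , _) , _ =
    Star.map (proj₂ ∘ proj₂) (conn a∈S b∈S)

  ⊤ : NCG
  ⊤ = record
    { graph       = G
    ; isBond      = record { subgraph = id ; induced = λ _ _ _ e → e }
    ; noncrossing = crossingsConnected⇒noncrossing G G-crossingsConnected
    }

  module _ (x y : NCG) where

    roots : Fin n → Fin n × Fin n
    roots i = root x i , root y i

    _≟²_ : DecidableEquality (Fin n × Fin n)
    _≟²_ = ≡-dec Fin._≟_ Fin._≟_

    intersection : Graph n
    intersection = kernel _≟²_ G roots

    intersection⁺ : ∀ {i j} → Edge (graph x) i j → Edge (graph y) i j → Edge intersection i j
    intersection⁺ e f =
      kernel⁺ _≟²_ G roots (edge-subgraph x e) (cong₂ _,_ (edge-root x e) (edge-root y f))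

    intersection⁻ : ∀ {i j} → Edge intersection i j → Edge (graph x) i j × Edge (graph y) i j
    intersection⁻ e =
      let g , eq = kernel⁻ _≟²_ G roots e
          p , q  = ,-injective eq
      in root-edge x p g , root-edge y q g

    -- Both components through a crossing pair of edges contain the minimal connected set around it.
    intersection-crossingsConnected : CrossingsConnected intersection
    intersection-crossingsConnected {a} {b} a<b b<c c<d ac bd
      with closed (proj₁ (kernel⁻ _≟²_ G roots ac)) (proj₁ (kernel⁻ _≟²_ G roots bd))
             (inj₁ (a<b , b<c , c<d))
    ... | S , ((conn , (a∈S , _) , (b∈S , _)) , _) , unique = Star.map inside (conn a∈S b∈S)
      where
      S⊆ : ∀ z → Edge (graph z) a _ → Edge (graph z) b _ → S Subset.⊆ component-subset z a
      S⊆ z e f = minimal-least {S = S} unique (crossing-connectedContaining z a<b b<c c<d e f)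

      inS : ∀ z → Edge (graph z) a _ → Edge (graph z) b _ →
        ∀ {i j} → InducedEdge G S i j → Edge (graph z) i j
      inS z e f (i∈S , j∈S , g) = connected-edge z
        (connected-sym (graph z) (∈-component⁻ z (S⊆ z e f i∈S)) ◅◅ ∈-component⁻ z (S⊆ z e f j∈S)) g

      inside : ∀ {i j} → InducedEdge G S i j → Edge intersection i j
      inside g =
        let xac , yac = intersection⁻ ac
            xbd , ybd = intersection⁻ bd
        in intersection⁺ (inS x xac xbd g) (inS y yac ybd g)

    _⋏_ : NCG
    _⋏_ = kernelBond _≟²_ G roots intersection-crossingsConnected

  isBoundedMeetSemilattice : IsBoundedMeetSemilattice _≈_ _≤_ _⋏_ ⊤
  isBoundedMeetSemilattice = record
    { isMeetSemilattice = record
      { isPartialOrder = isPartialOrder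
      ; infimum = λ x y → proj₁ ∘ intersection⁻ x y , proj₂ ∘ intersection⁻ x y ,
                          λ z z≤x z≤y e → intersection⁺ x y (z≤x e) (z≤y e)
      }
    ; maximum = λ x → edge-subgraph x
    }

  _≤?_ : Decidable _≤_
  x ≤? y = map′ (λ f {i} {j} → f i j) (λ f i j → f)
    (Fin.all? λ i → Fin.all? λ j → edge? (graph x) i j →-dec edge? (graph y) i j)

  -- Enumeration of the noncrossing bonds.

  module _ (f : Fin n → Fin n) where

    K : Graph n
    K = kernel Fin._≟_ G f

    K-perfect : PerfectlyLabeled K
    K-perfect = bond-perfectlyLabeled G K perfect (kernel-isBond Fin._≟_ G f)

    -- `CrossingsConnected` restated with equality of roots in place of connectedness, which makes
    -- it decidable by finite search.
    CrossingsAgree : Set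
    CrossingsAgree = ∀ a b c d → a < b → b < c → c < d → Edge K a c → Edge K b d →
      Roots.root K K-perfect a ≡ Roots.root K K-perfect b

    crossingsAgree? : Dec CrossingsAgree
    crossingsAgree? = Fin.all? λ a → Fin.all? λ b → Fin.all? λ c → Fin.all? λ d →
      (a Fin.<? b) →-dec ((b Fin.<? c) →-dec ((c Fin.<? d) →-dec
        (edge? K a c →-dec (edge? K b d →-dec (_ Fin.≟ _)))))

    candidate : NCG
    candidate with crossingsAgree?
    -- A default for maps whose kernel is crossing; repetitions in the enumeration are harmless.
    ... | no _   = ⊤
    ... | yes ok = kernelBond Fin._≟_ G f λ a<b b<c c<d ac bd →
      Roots.root-reflects K K-perfect (ok _ _ _ _ a<b b<c c<d ac bd)

  -- Each noncrossing bond is determined by its root map, so the `n ^ n` self-maps of the vertex set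
  -- suffice.
  bonds : List NCG
  bonds = map (candidate ∘ finToFun) (allFin (n ℕ.^ n))

  root-kernel : ∀ x f → (∀ i → f i ≡ root x i) → (graph x ⊆ᴱ K f) × (K f ⊆ᴱ graph x)
  root-kernel x f f≡ =
      (λ e → kernel⁺ Fin._≟_ G f (edge-subgraph x e)
        (trans (f≡ _) (trans (edge-root x e) (sym (f≡ _)))))
    , (λ e → let g , eq = kernel⁻ Fin._≟_ G f e
             in root-edge x (trans (sym (f≡ _)) (trans eq (f≡ _))) g)

  root-candidate : ∀ x f → (∀ i → f i ≡ root x i) → x ≈ candidate f
  root-candidate x f f≡ with crossingsAgree? f
  ... | yes _  = root-kernel x f f≡
  ... | no ¬ok = contradiction
    (λ a b c d a<b b<c c<d ac bd → Roots.root-cong (K f) (K-perfect f)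
      (Star.map x≤K (crossingsConnected x a<b b<c c<d (K≤x ac) (K≤x bd))))
    ¬ok
    where
    x≤K = proj₁ (root-kernel x f f≡)
    K≤x = proj₂ (root-kernel x f f≡)

  bonds-enumerate : IsEnumeration Eq.setoid bonds
  bonds-enumerate x = Any.map⁺ (Any.map
    (λ { refl → root-candidate x _ (Fin.finToFun-funToFin (root x)) })
    (∈-allFin (funToFin (root x))))

  open FiniteMeets.Join (NC G) {_⋏_} {⊤} isBoundedMeetSemilattice _≤?_ bonds-enumerate
    using (_⋎_; isLattice)

  -- Labels of bonds and merging with an initial segment.

  nonMinimal-mono : ∀ {x y : NCG} → x ≤ y → NonMinimal (graph x) ⊆ NonMinimal (graph y)
  nonMinimal-mono x≤y (i , i<j , e) = i , i<j , x≤y e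

  -- The `x`-roots of the ends of an edge of `y` are minimal in `x`, hence in `y` by the label
  -- inclusion, and they are connected in `y`. They therefore coincide, and the edge lies in `x`
  -- because `x` is induced on its components.
  nonMinimal-strict : ∀ {x y : NCG} → x ≤ y → NonMinimal (graph y) ⊆ NonMinimal (graph x) → y ≤ x
  nonMinimal-strict {x} {y} x≤y y⊆x {i} {j} e = root-edge x
    (XRoots.minimal-unique y
      (up (connected-sym (graph x) (XRoots.root-connected x i)) ◅◅ e ◅ up (XRoots.root-connected x j))
      (root-minimal x i ∘ y⊆x) (root-minimal x j ∘ y⊆x))
    (edge-subgraph y e)
    where
    up : ∀ {i j} → Connected (graph x) i j → Connected (graph y) i j
    up = Star.map x≤y

  -- The join of x with G[{0,…,k}]: the components of x with a vertex ≤ k are merged whenever they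
  -- lie in the same component of G.
  module _ (x : NCG) (k : ℕ) where

    level : Fin n → ℕ
    level i = toℕ (root x i) ⊔ k

    merged : Graph n
    merged = kernel ℕ._≟_ G level

    ≤merged : graph x ⊆ᴱ merged
    ≤merged e = kernel⁺ ℕ._≟_ G level (edge-subgraph x e) (cong (λ r → toℕ r ⊔ k) (edge-root x e))

    merged⁻ : ∀ {i j} → Edge merged i j →
      Edge (graph x) i j ⊎ (toℕ (root x i) ℕ.≤ k × toℕ (root x j) ℕ.≤ k)
    merged⁻ e = let g , eq = kernel⁻ ℕ._≟_ G level e in
      [ (λ p → inj₁ (root-edge x (Fin.toℕ-injective p) g)) , inj₂ ]′ (⊔-cancel _ _ k eq)

    merged-initial : ∀ {i j} → Edge G i j → toℕ i ℕ.≤ k → toℕ j ℕ.≤ k → Edge merged i j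
    merged-initial g i≤k j≤k = kernel⁺ ℕ._≟_ G level g
      (≤-⊔-cong (ℕ.≤-trans (root-≤ x _) i≤k) (ℕ.≤-trans (root-≤ x _) j≤k))

    merged-down : ∀ {i j} → toℕ i ℕ.≤ k → Star (Down G) i j → Connected merged i j
    merged-down i≤k ε                = ε
    merged-down i≤k ((j<i , e) ◅ p) = merged-initial e i≤k j≤k ◅ merged-down j≤k p
      where j≤k = ℕ.≤-trans (ℕ.<⇒≤ j<i) i≤k

    -- Passing to the `x`-roots gives two vertices at most `k`. By perfect labeling they descend in
    -- `G` to a common vertex, and a descent never leaves the vertices at most `k`.
    merged-connected : ∀ {i j} → Connected G i j →
      toℕ (root x i) ℕ.≤ k → toℕ (root x j) ℕ.≤ k → Connected merged i j
    merged-connected {i} {j} p ri≤k rj≤k =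
      let _ , i↓ , j↓ = GRoots.joinable
            (Star.map (edge-subgraph x) (connected-sym (graph x) (XRoots.root-connected x i))
              ◅◅ p ◅◅ Star.map (edge-subgraph x) (XRoots.root-connected x j))
      in Star.map ≤merged (XRoots.root-connected x i)
           ◅◅ merged-down ri≤k i↓ ◅◅ connected-sym merged (merged-down rj≤k j↓)
           ◅◅ connected-sym merged (Star.map ≤merged (XRoots.root-connected x j))

    merged-crossingsConnected : CrossingsConnected merged
    merged-crossingsConnected {a} {b} {c} {d} a<b b<c c<d ac bd =
      cases (toℕ (root x a) ℕ.≤? k) (toℕ (root x b) ℕ.≤? k) (merged⁻ ac) (merged⁻ bd)
      where
      ≢-root : ∀ {i j} → toℕ (root x i) ℕ.≤ k → ¬ toℕ (root x j) ℕ.≤ k → root x i ≢ root x j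
      ≢-root i≤k j≰k eq = j≰k (subst (λ r → toℕ r ℕ.≤ k) eq i≤k)

      cases : Dec (toℕ (root x a) ℕ.≤ k) → Dec (toℕ (root x b) ℕ.≤ k) →
        Edge (graph x) a c ⊎ (toℕ (root x a) ℕ.≤ k × toℕ (root x c) ℕ.≤ k) →
        Edge (graph x) b d ⊎ (toℕ (root x b) ℕ.≤ k × toℕ (root x d) ℕ.≤ k) →
        Connected merged a b
      cases (yes a≤k) (yes b≤k) _ _ = merged-connected
        (G-crossingsConnected a<b b<c c<d
          (proj₁ (kernel⁻ ℕ._≟_ G level ac)) (proj₁ (kernel⁻ ℕ._≟_ G level bd))) a≤k b≤k
      cases _ _ (inj₁ e) (inj₁ f) = Star.map ≤merged (crossingsConnected x a<b b<c c<d e f)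
      cases (no a≰k) _ (inj₂ (a≤k , _)) _ = contradiction a≤k a≰k
      cases _ (no b≰k) _ (inj₂ (b≤k , _)) = contradiction b≤k b≰k
      -- Here `root x b ≤ k < root x a ≤ a`, so `root x b < a < b < c` would be a crossing of two
      -- components of `x`.
      cases (no a≰k) _ (inj₁ e) (inj₂ (b≤k , _)) = ⊥-elim (not-crossing x (≢-root b≤k a≰k)
        (XRoots.root-connected x b) ε ε (e ◅ ε)
        (ℕ.≤-<-trans b≤k (ℕ.<-≤-trans (ℕ.≰⇒> a≰k) (root-≤ x a)) , a<b , b<c))
      -- Likewise `root x c ≤ k < root x b ≤ b` gives the crossing `root x c < b < c < d`.
      cases _ (no b≰k) (inj₂ (a≤k , c≤k)) (inj₁ f) = ⊥-elim (not-crossing x (≢-root c≤k b≰k)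
        (XRoots.root-connected x c) ε ε (f ◅ ε)
        (ℕ.≤-<-trans c≤k (ℕ.<-≤-trans (ℕ.≰⇒> b≰k) (root-≤ x b)) , b<c , c<d))

    merge : NCG
    merge = kernelBond ℕ._≟_ G level merged-crossingsConnected

  -- The maximal chain of initial segments.

  ⊥ : NCG
  ⊥ = kernelBond Fin._≟_ G id λ a<b b<c c<d ac bd →
    contradiction (Fin.<-trans a<b b<c) (Fin.<-irrefl (proj₂ (kernel⁻ Fin._≟_ G id ac)))

  ⊥-edgeless : ∀ {i j} → ¬ Edge (graph ⊥) i j
  ⊥-edgeless e with kernel⁻ Fin._≟_ G id e
  ... | g , refl = edge-irrefl G g

  -- Every vertex is its own root in `⊥`, so this is the bond mₖ with edge set G[{0,...,k}].
  initial : ℕ → NCG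
  initial = merge ⊥

  initial⁺ : ∀ k {i j} → Edge G i j → toℕ i ℕ.≤ k → toℕ j ℕ.≤ k → Edge (graph (initial k)) i j
  initial⁺ = merged-initial ⊥

  initial⁻ : ∀ k {i j} → Edge (graph (initial k)) i j → Edge G i j × toℕ i ℕ.≤ k × toℕ j ℕ.≤ k
  initial⁻ k {i} {j} e with merged⁻ ⊥ k e
  ... | inj₁ e′          = ⊥-elim (⊥-edgeless e′)
  ... | inj₂ (i≤k , j≤k) =
    edge-subgraph (initial k) e , subst (ℕ._≤ k) (root⊥ i) i≤k , subst (ℕ._≤ k) (root⊥ j) j≤k
    where
    root⊥ : ∀ i → toℕ (root ⊥ i) ≡ toℕ i
    root⊥ i = cong toℕ (XRoots.minimal⇒root ⊥ λ (_ , _ , e) → ⊥-edgeless e)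

  initial-mono : ∀ {k l} → k ℕ.≤ l → initial k ≤ initial l
  initial-mono {k} {l} k≤l e =
    let g , i≤k , j≤k = initial⁻ k e in initial⁺ l g (ℕ.≤-trans i≤k k≤l) (ℕ.≤-trans j≤k k≤l)

  initial-0 : ∀ x → initial 0 ≤ x
  initial-0 x {i} {j} e with initial⁻ 0 e
  ... | g , i≤0 , j≤0 = contradiction
    (subst (λ v → Edge G v j)
      (Fin.toℕ-injective (trans (ℕ.n≤0⇒n≡0 i≤0) (sym (ℕ.n≤0⇒n≡0 j≤0)))) g)
    (edge-irrefl G)

  initial-n : ∀ x → x ≤ initial n
  initial-n x {i} {j} e =
    initial⁺ n (edge-subgraph x e) (ℕ.<⇒≤ (Fin.toℕ<n i)) (ℕ.<⇒≤ (Fin.toℕ<n j))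

  L : Lattice 0ℓ 0ℓ 0ℓ
  L = record { isLattice = isLattice }

  open Lattice L using (x≤x∨y; ∨-least)

  Initial : Pred NCG 0ℓ
  Initial x = ∃[ k ] x ≈ initial k

  initial-isChain : IsChain L Initial
  initial-isChain (k , x≤k , k≤x) (l , y≤l , l≤y) with ℕ.≤-total k l
  ... | inj₁ k≤l = inj₁ λ e → l≤y (initial-mono k≤l (x≤k e))
  ... | inj₂ l≤k = inj₂ λ e → k≤x (initial-mono l≤k (y≤l e))

  initial-suc : ∀ k {v} → NonMinimal (graph (initial (suc k))) v →
    toℕ v ≡ suc k ⊎ NonMinimal (graph (initial k)) v
  initial-suc k (i , i<v , e) with initial⁻ (suc k) e
  ... | g , v≤1+k , _ with ℕ.m≤n⇒m<n∨m≡n v≤1+k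
  ... | inj₂ v≡1+k = inj₁ v≡1+k
  ... | inj₁ v<1+k = inj₂ (i , i<v , initial⁺ k g v≤k (ℕ.≤-trans (ℕ.<⇒≤ i<v) v≤k))
    where v≤k = ℕ.s≤s⁻¹ v<1+k

  -- By `initial-suc` the labels of consecutive members differ at most in the vertex `suc k`.
  -- Whether `x` has that vertex in its label decides which end it equals, by `nonMinimal-strict`.
  initial-covers : ∀ k x → initial k ≤ x → x ≤ initial (suc k) → x ∈ Initial
  initial-covers k x k≤x x≤1+k
    with Fin.any? (λ j → (toℕ j ℕ.≟ suc k) ×-dec nonMinimal? (graph x) j)
  ... | yes (j , j≡1+k , j∈x) = suc k , x≤1+k , nonMinimal-strict {x} {initial (suc k)} x≤1+k λ p →
    [ (λ v≡1+k → subst (NonMinimal (graph x)) (Fin.toℕ-injective (trans j≡1+k (sym v≡1+k))) j∈x)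
    , nonMinimal-mono {initial k} {x} k≤x
    ]′ (initial-suc k p)
  ... | no ∄j = k , nonMinimal-strict {initial k} {x} k≤x labels , k≤x
    where
    labels : NonMinimal (graph x) ⊆ NonMinimal (graph (initial k))
    labels p with initial-suc k (nonMinimal-mono {x} {initial (suc k)} x≤1+k p)
    ... | inj₁ v≡1+k = contradiction (_ , v≡1+k , p) ∄j
    ... | inj₂ q     = q

  -- Walking down from an upper bound in the chain, comparability eventually traps `x` between two
  -- consecutive members or brings it down to `initial 0`, the least bond.
  initial-reached : ∀ x → (∀ k → initial k ≤ x ⊎ x ≤ initial k) → ∀ k → x ≤ initial k → x ∈ Initial
  initial-reached x comparable zero    x≤0   = 0 , x≤0 , initial-0 x
  initial-reached x comparable (suc k) x≤1+k with comparable k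
  ... | inj₁ k≤x = initial-covers k x k≤x x≤1+k
  ... | inj₂ x≤k = initial-reached x comparable k x≤k

  initial-isMaximalChain : IsMaximalChain L Initial
  initial-isMaximalChain = (λ {x} {y} → initial-isChain {x} {y}) , λ c c-chain m⊆c {x} x∈c →
    initial-reached x (λ k → c-chain (m⊆c {initial k} (k , id , id)) x∈c) n (initial-n x)

  -- Joins and meets with the chain.

  -- If `j` is minimal in `x`, it is its own root. A new edge to a lower `i` then forces `j ≤ k`,
  -- hence also `i ≤ k`, so this edge already lies in `initial k`.
  nonMinimal-merge : ∀ x k →
    NonMinimal (graph (merge x k)) ⊆ NonMinimal (graph x) ∪ NonMinimal (graph (initial k))
  nonMinimal-merge x k {j} (i , i<j , e) = cases (nonMinimal? (graph x) j) (merged⁻ x k e)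
    where
    cases : Dec (NonMinimal (graph x) j) →
      Edge (graph x) j i ⊎ (toℕ (root x j) ℕ.≤ k × toℕ (root x i) ℕ.≤ k) →
      j ∈ NonMinimal (graph x) ∪ NonMinimal (graph (initial k))
    cases (yes j∈x) _                = inj₁ j∈x
    cases (no _)    (inj₁ e′)         = inj₁ (i , i<j , e′)
    cases (no j∉x)  (inj₂ (rj≤k , _)) =
      inj₂ (i , i<j , initial⁺ k (edge-subgraph (merge x k) e) j≤k (ℕ.≤-trans (ℕ.<⇒≤ i<j) j≤k))
      where j≤k = subst (λ r → toℕ r ℕ.≤ k) (XRoots.minimal⇒root x j∉x) rj≤k

  initial≤merge : ∀ x k → initial k ≤ merge x k
  initial≤merge x k e = let g , i≤k , j≤k = initial⁻ k e in merged-initial x k g i≤k j≤k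

  -- The bond `merge x k` is an upper bound of `x` and `a`, so the join lies below it and its label
  -- is bounded by `nonMinimal-merge`.
  nonMinimal-∨ : ∀ {a} x → a ∈ Initial →
    NonMinimal (graph (x ⋎ a)) ⊆ NonMinimal (graph x) ∪ NonMinimal (graph a)
  nonMinimal-∨ {a} x (k , a≤k , k≤a) p =
    [ inj₁ , inj₂ ∘ nonMinimal-mono {initial k} {a} k≤a ]′
      (nonMinimal-merge x k (nonMinimal-mono {x ⋎ a} {merge x k}
        (∨-least {x} {a} {merge x k} (≤merged x k) (λ e → initial≤merge x k (a≤k e))) p))

  -- Membership in the label of `a` gives `j ≤ k`; the edge of `x` from `j` to a smaller vertex then
  -- also lies in `initial k`.
  nonMinimal-∧ : ∀ {a} x → a ∈ Initial →
    NonMinimal (graph x) ∩ NonMinimal (graph a) ⊆ NonMinimal (graph (x ⋏ a))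
  nonMinimal-∧ {a} x (k , a≤k , k≤a) ((i , i<j , e) , (_ , _ , f)) =
    let _ , j≤k , _ = initial⁻ k (a≤k f)
    in i , i<j , intersection⁺ x a e
         (k≤a (initial⁺ k (edge-subgraph x e) j≤k (ℕ.≤-trans (ℕ.<⇒≤ i<j) j≤k)))

  isSupersolvable : IsSupersolvable L
  isSupersolvable = record
    { finite       = bonds , bonds-enumerate
    ; supersolving = Initial , initial-isMaximalChain , λ c c-chain →
        ModularChain.Labelled.distributive L (NonMinimal ∘ graph)
          (λ {x} {y} → nonMinimal-mono {x} {y}) (λ {x} {y} → nonMinimal-strict {x} {y})
          Initial (λ {x} {y} → initial-isChain {x} {y})
          (λ {a} → nonMinimal-∨ {a}) (λ {a} → nonMinimal-∧ {a})
          {initial n} {initial 0} (n , id , id) (0 , id , id)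
          initial-n initial-0 c c-chain
    }

theorem5p11 : (n : ℕ) (G : Graph n) → PerfectlyLabeled G → CrossingClosed G →
    IsSupersolvableLattice (NC G)
theorem5p11 n G perfect closed = record
  { isLattice = Lattice.isLattice L ; isSupersolvable = isSupersolvable }
  where open NoncrossingBonds G perfect closed
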